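{- As formal power series in $x$ with rational coefficients, the following two identities hold: (a) $\displaystyle A(-1;x)=\frac{\frac{d}{dx}F(x)}{F(x)}$; (b) $\displaystyle P^{\mathsf{pk}}(-1;x)=\frac{\frac{d}{dx}G(x)}{G(x)}$.
   Context: Let $\mathfrak{S}_n$ be the set of permutations $\pi=\pi_1\pi_2\cdots\pi_n$ (one-line notation) of $[n]=\{1,\dots,n\}$. A letter $\pi_i$ with $1\le i\le n-1$ is a descent of $\pi$ if $\pi_i>\pi_{i+1}$; a letter $\pi_i$ with $2\le i\le n-1$ is a peak of $\pi$ if $\pi_{i-1}<\pi_i>\pi_{i+1}$. Let $\mathsf{des}(\pi)$ and $\mathsf{pk}(\pi)$ be the numbers of descents and peaks of $\pi$. Define $A_n(t)=\sum_{\pi\in\mathfrak{S}_n}t^{\mathsf{des}(\pi)}$ and $P_n^{\mathsf{pk}}(t)=\sum_{\pi\in\mathfrak{S}_n}t^{\mathsf{pk}(\pi)}$, with exponential generating functions (without constant term) $A(t;x)=\sum_{n\ge1}A_n(t)\frac{x^n}{n!}$ and $P^{\mathsf{pk}}(t;x)=\sum_{n\ge1}P_n^{\mathsf{pk}}(t)\frac{x^n}{n!}$. Let $f_n=1$ if $n$ is even and $f_n=0$ if $n$ is odd ($n\ge 0$), and $F(x)=\sum_{n\ge0}f_n\frac{x^n}{n!}=\cosh(x)$. Let the (shifted) Pell numbers be defined by $g_0=1$, $g_1=0$, and $g_n=2g_{n-1}+g_{n-2}$ for $n\ge2$, and let $G(x)=\sum_{n\ge0}g_n\frac{x^n}{n!}$.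 -}

module Defs where

open import Algebra.Definitions.RawMonoid using (sum)
open import Algebra.Definitions.RawSemiring using (_^_)
open import Data.Bool.Base using (if_then_else_)
open import Data.Fin.Base as Fin using (Fin; toℕ)
open import Data.Fin.Properties using (_≟_; _<?_)
open import Data.Integer.Base using (+_)
open import Data.List.Base using (List; []; _∷_; allFin; cartesianProductWith; filter; foldr; map)
open import Data.Nat.Base as ℕ using (ℕ; zero; suc; _∸_; _!)
open import Data.Nat.Divisibility using (_∣?_)
open import Data.Nat.Properties using (_!≢0)
open import Data.Rational.Base as ℚ
  using (ℚ; NonZero; 0ℚ; 1ℚ; -_; _+_; _-_; _*_; _÷_; 1/_; +-0-rawMonoid; +-*-rawSemiring)
open import Data.Rational.Properties
  using (+-assoc; +-comm; +-identityʳ; +-inverseˡ; *-assoc; *-identityʳ; *-inverseˡ)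
open import Data.Vec.Base as Vec using (Vec; []; _∷_)
open import Data.Vec.Relation.Unary.AllPairs using (allPairs?)
open import Data.Vec.Relation.Unary.Unique.Propositional using (Unique)
open import Relation.Binary.PropositionalEquality using (_≗_; cong; module ≡-Reasoning)
open import Relation.Nullary.Decidable using (Dec; does; ¬?; _×-dec_)

-- A formal power series over ℚ is its sequence of coefficients; equality of
-- series is pointwise equality _≗_.
Series : Set
Series = ℕ → ℚ

fromℕ : ℕ → ℚ
fromℕ n = + n ℚ./ 1

infixl 7 _·_ _/_

_·_ : Series → Series → Series
(f · g) n = sum +-0-rawMonoid {suc n} λ i → f (toℕ i) * g (n ∸ toℕ i)

-- Long division: with c = f₀ / g₀, the quotient is c + x · q, where q is the
-- quotient of (f - c · g) / x by g.
_/_ : (f g : Series) → .{{NonZero (g 0)}} → Series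
(f / g) zero    = f 0 ÷ g 0
(f / g) (suc n) = ((λ m → f (suc m) - (f 0 ÷ g 0) * g (suc m)) / g) n

/-· : (f g : Series) .{{_ : NonZero (g 0)}} → (f / g) · g ≗ f
/-· f g zero = begin
  (f 0 ÷ g 0) * g 0 + 0ℚ     ≡⟨ +-identityʳ _ ⟩
  f 0 * (1/ g 0) * g 0       ≡⟨ *-assoc (f 0) (1/ g 0) (g 0) ⟩
  f 0 * ((1/ g 0) * g 0)     ≡⟨ cong (f 0 *_) (*-inverseˡ (g 0)) ⟩
  f 0 * 1ℚ                   ≡⟨ *-identityʳ (f 0) ⟩
  f 0                        ∎
  where open ≡-Reasoning
/-· f g (suc n) = begin
  c + ((f′ / g) · g) n         ≡⟨ cong (_+_ c) (/-· f′ g n) ⟩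
  c + (f (suc n) - c)          ≡⟨ +-comm c (f (suc n) - c) ⟩
  f (suc n) - c + c            ≡⟨ +-assoc (f (suc n)) (- c) c ⟩
  f (suc n) + (- c + c)        ≡⟨ cong (_+_ (f (suc n))) (+-inverseˡ c) ⟩
  f (suc n) + 0ℚ               ≡⟨ +-identityʳ (f (suc n)) ⟩
  f (suc n)                    ∎
  where
  open ≡-Reasoning
  c : ℚ
  c = (f 0 ÷ g 0) * g (suc n)
  f′ : Series
  f′ m = f (suc m) - (f 0 ÷ g 0) * g (suc m)

d/dx : Series → Series
d/dx f n = fromℕ (suc n) * f (suc n)

egf : (ℕ → ℚ) → Series
egf a n = a n * (+ 1 ℚ./ n !) {{n !≢0}}

egf⁺ : (ℕ → ℚ) → Series
egf⁺ a zero    = 0ℚ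
egf⁺ a (suc n) = egf a (suc n)

words : (n k : ℕ) → List (Vec (Fin n) k)
words n zero    = [] ∷ []
words n (suc k) = cartesianProductWith _∷_ (allFin n) (words n k)

unique? : ∀ {n k} (w : Vec (Fin n) k) → Dec (Unique w)
unique? = allPairs? λ i j → ¬? (i ≟ j)

-- Permutations in one-line notation: the words of length n over an n-letter
-- ordered alphabet without repeated letters.
𝔖 : (n : ℕ) → List (Vec (Fin n) n)
𝔖 n = filter unique? (words n n)

des : ∀ {n k} → Vec (Fin n) k → ℕ
des (x ∷ y ∷ w) = (if does (y <? x) then 1 else 0) ℕ.+ des (y ∷ w)
des _           = 0

pk : ∀ {n k} → Vec (Fin n) k → ℕ
pk (x ∷ y ∷ z ∷ w) = (if does (x <? y ×-dec z <? y) then 1 else 0) ℕ.+ pk (y ∷ z ∷ w)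
pk _               = 0

-- The polynomial Σ_{π ∈ 𝔖ₙ} t^{st(π)}, as a function of t.
statPoly : (∀ {n} → Vec (Fin n) n → ℕ) → ℕ → ℚ → ℚ
statPoly st n t = foldr _+_ 0ℚ (map (λ π → _^_ +-*-rawSemiring t (st π)) (𝔖 n))

Aₙ : ℕ → ℚ → ℚ
Aₙ = statPoly des

Pₙᵖᵏ : ℕ → ℚ → ℚ
Pₙᵖᵏ = statPoly pk

A : ℚ → Series
A t = egf⁺ λ n → Aₙ n t

Pᵖᵏ : ℚ → Series
Pᵖᵏ t = egf⁺ λ n → Pₙᵖᵏ n t

f : ℕ → ℚ
f n = if does (2 ∣? n) then 1ℚ else 0ℚ

g : ℕ → ℚ
g 0             = 1ℚ
g 1             = 0ℚ
g (suc (suc n)) = fromℕ 2 * g (suc n) + g n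

F : Series
F = egf f

G : Series
G = egf g

-- Both statistics are encoded at t = -1 by a product of weights over the
-- descents. Deleting the first letter j of a permutation and standardizing the
-- rest gives a transfer rule for the weighted count with given first letter.
-- It splits according to whether the next letter is below j, so its partial
-- sums over first letters are Leibniz (binomial) products α ⊛ U, where U counts
-- permutations preceded by an ascent and α solves a linear ODE. In terms of
-- K = e⁻ˣ h and L = e⁻ˣ h′ with h″ = (1 + s) h′ + h, this reads K U = 1, and the
-- weighted count without constant term is L U = h′ / h. The values s = -1, 1
-- give h = F, G.

module Submission where

open import Defs
open import Data.Product.Base using (_×_)
open import Data.Rational.Base using (-_; 1ℚ)
open import Relation.Binary.PropositionalEquality using (_≗_)
open import Algebra.Bundles using (CommutativeRing)
open import Algebra.Definitions.RawSemiring using (_^_)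
import Algebra.Properties.Semiring.Sum
open import Data.Bool.Base using (Bool; true; false; if_then_else_; not; _∧_)
open import Data.Fin.Base as Fin using (Fin; toℕ; zero; suc; punchIn; inject₁)
open import Data.Fin.Properties
  using (_≟_; _<?_; <-cmp; punchIn-injective; punchInᵢ≢i; punchIn-mono-≤; punchIn-cancel-≤;
         toℕ≤pred[n]; toℕ-inject₁; toℕ-fromℕ)
import Data.Integer.Base as ℤ
import Data.Integer.Properties as ℤ
open import Data.List.Base using (List; []; _∷_; _++_; allFin; cartesianProductWith; filter; foldr; map; tabulate)
open import Data.Nat.Base as ℕ using (ℕ; zero; suc; _∸_; _!)
open import Data.Nat.Divisibility using (_∣?_; ∣m+n∣m⇒∣n; ∣m∣n⇒∣m+n; ∣-refl)
import Data.Nat.Properties as ℕ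
open import Data.Product.Base using (_,_)
open import Data.Rational.Base as ℚ
  using (ℚ; 0ℚ; _+_; _-_; _*_; _÷_; 1/_; toℚᵘ; NonZero; Positive; +-*-rawSemiring)
import Data.Rational.Properties as ℚ
open import Data.Rational.Solver using (module +-*-Solver)
open import Data.Rational.Unnormalised.Base as ℚᵘ using (mkℚᵘ; *≡*)
import Data.Rational.Unnormalised.Properties as ℚᵘ
open import Data.Vec.Base as Vec using (Vec; []; _∷_)
open import Data.Vec.Relation.Unary.All as All using (All; all?; _∷_)
import Data.Vec.Relation.Unary.All.Properties as All
open import Data.Vec.Relation.Unary.AllPairs using ([]; _∷_)
open import Data.Vec.Relation.Unary.Unique.Propositional using (Unique)
import Data.Vec.Relation.Unary.Unique.Propositional.Properties as Unique
open import Function.Base using (_∘_; id)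
open import Function.Bundles using (mk⇔)
open import Relation.Binary.Definitions using (tri<; tri≈; tri>)
open import Relation.Binary.PropositionalEquality
  using (_≡_; _≢_; refl; sym; trans; cong; cong₂; module ≡-Reasoning)
open import Relation.Nullary.Decidable using (Dec; yes; no; does; ¬?; dec-true; dec-false; does-⇔)
open import Relation.Nullary.Negation using (contradiction)
open import Relation.Unary using (Decidable)
open +-*-Solver using (solve; _:=_; _:+_; _:*_; _:-_; con)

private module ∑ = Algebra.Properties.Semiring.Sum (CommutativeRing.semiring ℚ.+-*-commutativeRing)
open ∑ using (sum)

-- Algebra of the binomial (Leibniz) product.

infixl 7 _⊛_

-- The product of egfs read on their coefficient sequences; taking the Leibniz
-- rule as its definition avoids binomial coefficients.
_⊛_ : Series → Series → Series
(a ⊛ b) zero    = a 0 * b 0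
(a ⊛ b) (suc n) = (a ∘ suc ⊛ b) n + (a ⊛ b ∘ suc) n

⊛-cong : ∀ {a a′ b b′} → a ≗ a′ → b ≗ b′ → a ⊛ b ≗ a′ ⊛ b′
⊛-cong a≗a′ b≗b′ zero    = cong₂ _*_ (a≗a′ 0) (b≗b′ 0)
⊛-cong a≗a′ b≗b′ (suc n) =
  cong₂ _+_ (⊛-cong (a≗a′ ∘ suc) b≗b′ n) (⊛-cong a≗a′ (b≗b′ ∘ suc) n)

⊛-comm : ∀ a b → a ⊛ b ≗ b ⊛ a
⊛-comm a b zero    = ℚ.*-comm (a 0) (b 0)
⊛-comm a b (suc n) = trans
  (cong₂ _+_ (⊛-comm (a ∘ suc) b n) (⊛-comm a (b ∘ suc) n))
  (ℚ.+-comm ((b ⊛ a ∘ suc) n) ((b ∘ suc ⊛ a) n))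

⊛-scaleˡ : ∀ x a b n → ((λ m → x * a m) ⊛ b) n ≡ x * (a ⊛ b) n
⊛-scaleˡ x a b zero    = ℚ.*-assoc x (a 0) (b 0)
⊛-scaleˡ x a b (suc n) = trans
  (cong₂ _+_ (⊛-scaleˡ x (a ∘ suc) b n) (⊛-scaleˡ x a (b ∘ suc) n))
  (sym (ℚ.*-distribˡ-+ x ((a ∘ suc ⊛ b) n) ((a ⊛ b ∘ suc) n)))

⊛-distribʳ-+ : ∀ a b c n → ((λ m → a m + b m) ⊛ c) n ≡ (a ⊛ c) n + (b ⊛ c) n
⊛-distribʳ-+ a b c zero    = ℚ.*-distribʳ-+ (c 0) (a 0) (b 0)
⊛-distribʳ-+ a b c (suc n) = trans
  (cong₂ _+_ (⊛-distribʳ-+ (a ∘ suc) (b ∘ suc) c n) (⊛-distribʳ-+ a b (c ∘ suc) n))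
  (solve 4 (λ x y z w → x :+ y :+ (z :+ w) := x :+ z :+ (y :+ w)) refl
    ((a ∘ suc ⊛ c) n) ((b ∘ suc ⊛ c) n) ((a ⊛ c ∘ suc) n) ((b ⊛ c ∘ suc) n))

⊛-distribˡ-+ : ∀ a b c n → (a ⊛ (λ m → b m + c m)) n ≡ (a ⊛ b) n + (a ⊛ c) n
⊛-distribˡ-+ a b c n = begin
  (a ⊛ (λ m → b m + c m)) n    ≡⟨ ⊛-comm a (λ m → b m + c m) n ⟩
  ((λ m → b m + c m) ⊛ a) n    ≡⟨ ⊛-distribʳ-+ b c a n ⟩
  (b ⊛ a) n + (c ⊛ a) n        ≡⟨ cong₂ _+_ (⊛-comm b a n) (⊛-comm c a n) ⟩
  (a ⊛ b) n + (a ⊛ c) n        ∎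
  where open ≡-Reasoning

⊛-assoc : ∀ a b c → (a ⊛ b) ⊛ c ≗ a ⊛ (b ⊛ c)
⊛-assoc a b c zero    = ℚ.*-assoc (a 0) (b 0) (c 0)
⊛-assoc a b c (suc n) = begin
  ((λ m → (a′ ⊛ b) m + (a ⊛ b′) m) ⊛ c) n + ((a ⊛ b) ⊛ c′) n
    ≡⟨ cong (_+ ((a ⊛ b) ⊛ c′) n) (⊛-distribʳ-+ (a′ ⊛ b) (a ⊛ b′) c n) ⟩
  ((a′ ⊛ b) ⊛ c) n + ((a ⊛ b′) ⊛ c) n + ((a ⊛ b) ⊛ c′) n
    ≡⟨ cong₂ _+_ (cong₂ _+_ (⊛-assoc a′ b c n) (⊛-assoc a b′ c n)) (⊛-assoc a b c′ n) ⟩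
  (a′ ⊛ (b ⊛ c)) n + (a ⊛ (b′ ⊛ c)) n + (a ⊛ (b ⊛ c′)) n
    ≡⟨ ℚ.+-assoc ((a′ ⊛ (b ⊛ c)) n) ((a ⊛ (b′ ⊛ c)) n) ((a ⊛ (b ⊛ c′)) n) ⟩
  (a′ ⊛ (b ⊛ c)) n + ((a ⊛ (b′ ⊛ c)) n + (a ⊛ (b ⊛ c′)) n)
    ≡⟨ cong ((a′ ⊛ (b ⊛ c)) n +_) (⊛-distribˡ-+ a (b′ ⊛ c) (b ⊛ c′) n) ⟨
  (a′ ⊛ (b ⊛ c)) n + (a ⊛ (λ m → (b′ ⊛ c) m + (b ⊛ c′) m)) n
    ∎
  where
  open ≡-Reasoning
  a′ b′ c′ : Series
  a′ = a ∘ suc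
  b′ = b ∘ suc
  c′ = c ∘ suc

δ : Series
δ zero    = 1ℚ
δ (suc _) = 0ℚ

⊛-zeroˡ : ∀ a n → ((λ _ → 0ℚ) ⊛ a) n ≡ 0ℚ
⊛-zeroˡ a zero    = ℚ.*-zeroˡ (a 0)
⊛-zeroˡ a (suc n) = cong₂ _+_ (⊛-zeroˡ a n) (⊛-zeroˡ (a ∘ suc) n)

⊛-identityˡ : ∀ a → δ ⊛ a ≗ a
⊛-identityˡ a zero    = ℚ.*-identityˡ (a 0)
⊛-identityˡ a (suc n) = trans
  (cong₂ _+_ (⊛-zeroˡ a n) (⊛-identityˡ (a ∘ suc) n))
  (ℚ.+-identityˡ (a (suc n)))

-- Exponential generating functions: derivative, product and quotient.

fromℕ-+ : ∀ m n → fromℕ (m ℕ.+ n) ≡ fromℕ m + fromℕ n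
fromℕ-+ m n = ℚ.toℚᵘ-injective (begin
  toℚᵘ (fromℕ (m ℕ.+ n))                 ≈⟨ ℚ.toℚᵘ-fromℚᵘ (mkℚᵘ (ℤ.+ (m ℕ.+ n)) 0) ⟩
  mkℚᵘ (ℤ.+ (m ℕ.+ n)) 0                   ≈⟨ *≡* (cong (ℤ._* ℤ.+ 1) (cong₂ ℤ._+_ (sym (ℤ.*-identityʳ (ℤ.+ m))) (sym (ℤ.*-identityʳ (ℤ.+ n))))) ⟩
  mkℚᵘ (ℤ.+ m) 0 ℚᵘ.+ mkℚᵘ (ℤ.+ n) 0         ≈⟨ ℚᵘ.+-cong (ℚ.toℚᵘ-fromℚᵘ (mkℚᵘ (ℤ.+ m) 0)) (ℚ.toℚᵘ-fromℚᵘ (mkℚᵘ (ℤ.+ n) 0)) ⟨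
  toℚᵘ (fromℕ m) ℚᵘ.+ toℚᵘ (fromℕ n)     ≈⟨ ℚ.toℚᵘ-homo-+ (fromℕ m) (fromℕ n) ⟨
  toℚᵘ (fromℕ m + fromℕ n)               ∎)
  where open ℚᵘ.≃-Reasoning

fromℕ-*-1/ : ∀ m k .{{_ : ℕ.NonZero k}} .{{_ : ℕ.NonZero (suc m ℕ.* k)}} →
             fromℕ (suc m) * (ℤ.+ 1 ℚ./ (suc m ℕ.* k)) ≡ ℤ.+ 1 ℚ./ k
fromℕ-*-1/ m (suc k) = ℚ.toℚᵘ-injective (begin
  toℚᵘ (fromℕ (suc m) * (ℤ.+ 1 ℚ./ (suc m ℕ.* suc k)))
    ≈⟨ ℚ.toℚᵘ-homo-* (fromℕ (suc m)) (ℤ.+ 1 ℚ./ (suc m ℕ.* suc k)) ⟩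
  toℚᵘ (fromℕ (suc m)) ℚᵘ.* toℚᵘ (ℤ.+ 1 ℚ./ (suc m ℕ.* suc k))
    ≈⟨ ℚᵘ.*-cong (ℚ.toℚᵘ-fromℚᵘ (mkℚᵘ (ℤ.+ suc m) 0)) (ℚ.toℚᵘ-fromℚᵘ (mkℚᵘ (ℤ.+ 1) (k ℕ.+ m ℕ.* suc k))) ⟩
  mkℚᵘ (ℤ.+ suc m) 0 ℚᵘ.* mkℚᵘ (ℤ.+ 1) (k ℕ.+ m ℕ.* suc k)
    ≈⟨ *≡* (cong ℤ.+_ (trans (cong (ℕ._* suc k) (ℕ.*-identityʳ (suc m))) (sym (trans (ℕ.*-identityˡ _) (ℕ.*-identityˡ _))))) ⟩
  mkℚᵘ (ℤ.+ 1) k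
    ≈⟨ ℚ.toℚᵘ-fromℚᵘ (mkℚᵘ (ℤ.+ 1) k) ⟨
  toℚᵘ (ℤ.+ 1 ℚ./ suc k)
    ∎)
  where open ℚᵘ.≃-Reasoning

d/dx-egf : ∀ a → d/dx (egf a) ≗ egf (a ∘ suc)
d/dx-egf a n = begin
  fromℕ (suc n) * (a (suc n) * x)    ≡⟨ solve 3 (λ m a x → m :* (a :* x) := a :* (m :* x)) refl (fromℕ (suc n)) (a (suc n)) x ⟩
  a (suc n) * (fromℕ (suc n) * x)    ≡⟨ cong (a (suc n) *_) (fromℕ-*-1/ n (n !) {{n ℕ.!≢0}} {{suc n ℕ.!≢0}}) ⟩
  egf (a ∘ suc) n                    ∎
  where
  open ≡-Reasoning
  x : ℚ
  x = (ℤ.+ 1 ℚ./ (suc n) !) {{suc n ℕ.!≢0}}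

-- The Euler operator x d/dx. It preserves degrees, so its Leibniz rule can be checked term by term
-- inside a Cauchy product, and `d/dx a` is its shift.
θ : Series → Series
θ a n = fromℕ n * a n

·-suc : ∀ a b → b 0 ≡ 0ℚ → ∀ n → (a · b) (suc n) ≡ (a · b ∘ suc) n
·-suc a b b₀≡0 zero = cong (a 0 * b 1 +_) (begin
  a 1 * b 0 + 0ℚ    ≡⟨ ℚ.+-identityʳ (a 1 * b 0) ⟩
  a 1 * b 0         ≡⟨ cong (a 1 *_) b₀≡0 ⟩
  a 1 * 0ℚ          ≡⟨ ℚ.*-zeroʳ (a 1) ⟩
  0ℚ                ∎)
  where open ≡-Reasoning
·-suc a b b₀≡0 (suc n) = cong (a 0 * b (suc (suc n)) +_) (·-suc (a ∘ suc) b b₀≡0 n)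

θ-leibniz : ∀ a b n → θ (a · b) n ≡ (θ a · b) n + (a · θ b) n
θ-leibniz a b n = begin
  fromℕ n * (a · b) n
    ≡⟨ ∑.*-distribˡ-sum {suc n} (fromℕ n) (λ i → a (toℕ i) * b (n ∸ toℕ i)) ⟩
  sum {suc n} (λ i → fromℕ n * (a (toℕ i) * b (n ∸ toℕ i)))
    ≡⟨ ∑.sum-cong-≗ {suc n} term ⟩
  sum {suc n} (λ i → θ a (toℕ i) * b (n ∸ toℕ i) + a (toℕ i) * θ b (n ∸ toℕ i))
    ≡⟨ ∑.∑-distrib-+ {suc n} (λ i → θ a (toℕ i) * b (n ∸ toℕ i)) (λ i → a (toℕ i) * θ b (n ∸ toℕ i)) ⟩
  (θ a · b) n + (a · θ b) n
    ∎
  where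
  open ≡-Reasoning
  term : ∀ (i : Fin (suc n)) → fromℕ n * (a (toℕ i) * b (n ∸ toℕ i)) ≡
         θ a (toℕ i) * b (n ∸ toℕ i) + a (toℕ i) * θ b (n ∸ toℕ i)
  term i = trans
    -- The degree splits as n = i + (n - i), one summand for each factor.
    (cong (_* (a (toℕ i) * b (n ∸ toℕ i)))
      (trans (cong fromℕ (sym (ℕ.m+[n∸m]≡n (toℕ≤pred[n] i)))) (fromℕ-+ (toℕ i) (n ∸ toℕ i))))
    (solve 4 (λ k l a b → (k :+ l) :* (a :* b) := k :* a :* b :+ a :* (l :* b)) refl
      (fromℕ (toℕ i)) (fromℕ (n ∸ toℕ i)) (a (toℕ i)) (b (n ∸ toℕ i)))

d/dx-leibniz : ∀ a b n → d/dx (a · b) n ≡ (d/dx a · b) n + (a · d/dx b) n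
d/dx-leibniz a b n = begin
  d/dx (a · b) n                                             ≡⟨ θ-leibniz a b (suc n) ⟩
  0ℚ * a 0 * b (suc n) + (d/dx a · b) n + (a · θ b) (suc n)
    -- Both `θ a` and `θ b` have constant term 0: the first kills the leading term, the second lets
    -- `·-suc` shift the other sum.
    ≡⟨ cong₂ _+_
         (trans (cong (_+ (d/dx a · b) n) (trans (cong (_* b (suc n)) (ℚ.*-zeroˡ (a 0))) (ℚ.*-zeroˡ (b (suc n)))))
                (ℚ.+-identityˡ ((d/dx a · b) n)))
         (·-suc a (θ b) (ℚ.*-zeroˡ (b 0)) n) ⟩
  (d/dx a · b) n + (a · d/dx b) n                            ∎
  where open ≡-Reasoning

fromℕ-suc-cancelˡ : ∀ n {x y} → fromℕ (suc n) * x ≡ fromℕ (suc n) * y → x ≡ y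
fromℕ-suc-cancelˡ n eq = ℚ.≤-antisym
  (ℚ.*-cancelˡ-≤-pos r (ℚ.≤-reflexive eq))
  (ℚ.*-cancelˡ-≤-pos r (ℚ.≤-reflexive (sym eq)))
  where
  r = fromℕ (suc n)
  instance
    r>0 : Positive r
    r>0 = ℚ.normalize-pos (suc n) 1

·-cong : ∀ {a a′ b b′} → a ≗ a′ → b ≗ b′ → a · b ≗ a′ · b′
·-cong a≗a′ b≗b′ n = ∑.sum-cong-≗ {suc n} λ i → cong₂ _*_ (a≗a′ (toℕ i)) (b≗b′ (n ∸ toℕ i))

-- Both sides obey the Leibniz rule, so the coefficient at `suc n`, multiplied by `suc n`, reduces
-- to coefficient n for the shifted sequences.
egf-⊛ : ∀ a b → egf (a ⊛ b) ≗ egf a · egf b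
egf-⊛ a b zero = solve 2 (λ a b → a :* b :* con 1ℚ := a :* con 1ℚ :* (b :* con 1ℚ) :+ con 0ℚ) refl (a 0) (b 0)
egf-⊛ a b (suc n) = fromℕ-suc-cancelˡ n (begin
  d/dx (egf (a ⊛ b)) n                                        ≡⟨ d/dx-egf (a ⊛ b) n ⟩
  egf (λ m → (a ∘ suc ⊛ b) m + (a ⊛ b ∘ suc) m) n             ≡⟨ ℚ.*-distribʳ-+ _ ((a ∘ suc ⊛ b) n) ((a ⊛ b ∘ suc) n) ⟩
  egf (a ∘ suc ⊛ b) n + egf (a ⊛ b ∘ suc) n                   ≡⟨ cong₂ _+_ (egf-⊛ (a ∘ suc) b n) (egf-⊛ a (b ∘ suc) n) ⟩
  (egf (a ∘ suc) · egf b) n + (egf a · egf (b ∘ suc)) n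
    ≡⟨ cong₂ _+_ (·-cong {b = egf b} (d/dx-egf a) (λ _ → refl) n) (·-cong {egf a} (λ _ → refl) (d/dx-egf b) n) ⟨
  (d/dx (egf a) · egf b) n + (egf a · d/dx (egf b)) n         ≡⟨ d/dx-leibniz (egf a) (egf b) n ⟨
  d/dx (egf a · egf b) n                                      ∎)
  where open ≡-Reasoning

-- Follows the long division: the constant terms force `q 0`, and the shift of q is again a quotient
-- by b, now of the remainder.
/-unique : ∀ q a b .{{_ : NonZero (b 0)}} → q · b ≗ a → q ≗ a / b
/-unique q a b q·b≗a = unique
  where
  open ≡-Reasoning
  q₀ : q 0 ≡ a 0 ÷ b 0
  q₀ = begin
    q 0                          ≡⟨ ℚ.*-identityʳ (q 0) ⟨
    q 0 * 1ℚ                     ≡⟨ cong (q 0 *_) (ℚ.*-inverseʳ (b 0)) ⟨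
    q 0 * (b 0 * 1/ b 0)         ≡⟨ ℚ.*-assoc (q 0) (b 0) (1/ b 0) ⟨
    q 0 * b 0 * 1/ b 0           ≡⟨ cong (_* 1/ b 0) (ℚ.+-identityʳ (q 0 * b 0)) ⟨
    (q 0 * b 0 + 0ℚ) * 1/ b 0    ≡⟨ cong (_* 1/ b 0) (q·b≗a 0) ⟩
    a 0 ÷ b 0                    ∎
  unique : q ≗ a / b
  unique zero    = q₀
  unique (suc n) = /-unique (q ∘ suc) _ b (λ m → begin
    (q ∘ suc · b) m                                              ≡⟨ solve 2 (λ x y → y := x :+ y :- x) refl (q 0 * b (suc m)) _ ⟩
    (q · b) (suc m) - q 0 * b (suc m)                            ≡⟨ cong₂ (λ x y → x - y * b (suc m)) (q·b≗a (suc m)) q₀ ⟩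
    a (suc m) - (a 0 ÷ b 0) * b (suc m)                          ∎) n

-- Sums over words and permutations.

private variable
  X Y Z : Set
  k m n : ℕ

total : List X → (X → ℚ) → ℚ
total xs φ = foldr _+_ 0ℚ (map φ xs)

guard : Bool → ℚ → ℚ
guard b x = if b then x else 0ℚ

total-cong : ∀ {φ ψ : X → ℚ} → φ ≗ ψ → ∀ xs → total xs φ ≡ total xs ψ
total-cong φ≗ψ []       = refl
total-cong φ≗ψ (x ∷ xs) = cong₂ _+_ (φ≗ψ x) (total-cong φ≗ψ xs)

total-zero : ∀ (xs : List X) → total xs (λ _ → 0ℚ) ≡ 0ℚ
total-zero []       = refl
total-zero (x ∷ xs) = trans (ℚ.+-identityˡ _) (total-zero xs)

total-scale : ∀ c (φ : X → ℚ) xs → total xs (λ x → c * φ x) ≡ c * total xs φ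
total-scale c φ []       = sym (ℚ.*-zeroʳ c)
total-scale c φ (x ∷ xs) = trans (cong (_+_ (c * φ x)) (total-scale c φ xs))
                                 (sym (ℚ.*-distribˡ-+ c (φ x) (total xs φ)))

total-++-map : ∀ (φ : Y → ℚ) (h : X → Y) xs ys →
               total (map h xs ++ ys) φ ≡ total xs (φ ∘ h) + total ys φ
total-++-map φ h []       ys = sym (ℚ.+-identityˡ (total ys φ))
total-++-map φ h (x ∷ xs) ys = trans (cong (_+_ (φ (h x))) (total-++-map φ h xs ys))
                                     (sym (ℚ.+-assoc (φ (h x)) _ _))

total-cartesianProductWith : ∀ (φ : Z → ℚ) (h : X → Y → Z) xs ys →
  total (cartesianProductWith h xs ys) φ ≡ total xs (λ x → total ys (φ ∘ h x))
total-cartesianProductWith φ h []       ys = refl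
total-cartesianProductWith φ h (x ∷ xs) ys =
  trans (total-++-map φ (h x) ys (cartesianProductWith h xs ys))
        (cong (_+_ (total ys (φ ∘ h x))) (total-cartesianProductWith φ h xs ys))

total-tabulate : ∀ (h : Fin n → X) (φ : X → ℚ) → total (tabulate h) φ ≡ sum (φ ∘ h)
total-tabulate {n = zero}  h φ = refl
total-tabulate {n = suc _} h φ = cong (_+_ (φ (h zero))) (total-tabulate (h ∘ suc) φ)

total-filter : ∀ {P : X → Set} (P? : Decidable P) (φ : X → ℚ) xs →
               total (filter P? xs) φ ≡ total xs (λ x → guard (does (P? x)) (φ x))
total-filter P? φ []       = refl
total-filter P? φ (x ∷ xs) with does (P? x)
... | true  = cong (_+_ (φ x)) (total-filter P? φ xs)
... | false = trans (total-filter P? φ xs) (sym (ℚ.+-identityˡ _))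

total-filter-cong : ∀ {P : X → Set} (P? : Decidable P) {φ ψ : X → ℚ} →
                    (∀ x → P x → φ x ≡ ψ x) → ∀ xs → total (filter P? xs) φ ≡ total (filter P? xs) ψ
total-filter-cong P? φ≡ψ []       = refl
total-filter-cong P? φ≡ψ (x ∷ xs) with P? x
... | yes px = cong₂ _+_ (φ≡ψ x px) (total-filter-cong P? φ≡ψ xs)
... | no  _  = total-filter-cong P? φ≡ψ xs

total-words : ∀ (φ : Vec (Fin n) (suc k) → ℚ) →
              total (words n (suc k)) φ ≡ sum λ i → total (words n k) (φ ∘ (i ∷_))
total-words {n} {k} φ = trans (total-cartesianProductWith φ _∷_ (allFin n) (words n k))
                              (total-tabulate {n = n} id (λ i → total (words n k) (φ ∘ (i ∷_))))

∉? : (j : Fin n) (w : Vec (Fin n) k) → Dec (All (j ≢_) w)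
∉? j = all? λ i → ¬? (j ≟ i)

-- Induction on the length: a first letter equal to j contributes nothing, and every other first
-- letter is `punchIn j i` for exactly one i.
total-words-avoiding : ∀ (j : Fin (suc m)) (φ : Vec (Fin (suc m)) k → ℚ) →
  total (words (suc m) k) (λ w → guard (does (∉? j w)) (φ w)) ≡
  total (words m k) (φ ∘ Vec.map (punchIn j))
total-words-avoiding         {k = zero}  j φ = refl
total-words-avoiding {m = m} {k = suc k} j φ = begin
  total (words (suc m) (suc k)) (λ w → guard (does (∉? j w)) (φ w))
    ≡⟨ total-words {suc m} {k} _ ⟩
  sum t
    ≡⟨ ∑.sum-remove {i = j} t ⟩
  t j + sum (t ∘ punchIn j)
    ≡⟨ cong₂ _+_ t-j (∑.sum-cong-≗ t-punchIn) ⟩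
  0ℚ + sum (λ i → total (words m k) (λ w → φ (punchIn j i ∷ Vec.map (punchIn j) w)))
    ≡⟨ ℚ.+-identityˡ _ ⟩
  sum (λ i → total (words m k) (λ w → φ (punchIn j i ∷ Vec.map (punchIn j) w)))
    ≡⟨ total-words {m} {k} (φ ∘ Vec.map (punchIn j)) ⟨
  total (words m (suc k)) (φ ∘ Vec.map (punchIn j))
    ∎
  where
  open ≡-Reasoning
  t : Fin (suc m) → ℚ
  t i = total (words (suc m) k) (λ w → guard (not (does (j ≟ i)) ∧ does (∉? j w)) (φ (i ∷ w)))
  t-j : t j ≡ 0ℚ
  t-j rewrite dec-true (j ≟ j) refl = total-zero (words (suc m) k)
  t-punchIn : ∀ i → t (punchIn j i) ≡ total (words m k) (λ w → φ (punchIn j i ∷ Vec.map (punchIn j) w))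
  t-punchIn i rewrite dec-false (j ≟ punchIn j i) (punchInᵢ≢i j i ∘ sym) =
    total-words-avoiding j (φ ∘ (punchIn j i ∷_))

unique-map⁻ : ∀ (h : X → Y) {w : Vec X k} → Unique (Vec.map h w) → Unique w
unique-map⁻ h {[]}    []       = []
unique-map⁻ h {_ ∷ _} (p ∷ ps) = All.map (λ hx≢hy → hx≢hy ∘ cong h) (All.map⁻ p) ∷ unique-map⁻ h ps

guard-∧ : ∀ a b x → guard (a ∧ b) x ≡ guard a (guard b x)
guard-∧ true  b x = refl
guard-∧ false b x = refl

-- Deletion of the first letter j and standardization of the rest. Since `punchIn j` is injective,
-- relabelling back neither creates nor destroys repetitions.
total-𝔖 : ∀ n (φ : Vec (Fin (suc n)) (suc n) → ℚ) →
          total (𝔖 (suc n)) φ ≡ sum λ j → total (𝔖 n) λ σ → φ (j ∷ Vec.map (punchIn j) σ)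
total-𝔖 n φ = begin
  total (𝔖 (suc n)) φ
    ≡⟨ total-filter unique? φ (words (suc n) (suc n)) ⟩
  total (words (suc n) (suc n)) (λ w → guard (does (unique? w)) (φ w))
    ≡⟨ total-words {suc n} {n} _ ⟩
  sum (λ j → total (words (suc n) n) (λ w → guard (does (∉? j w) ∧ does (unique? w)) (φ (j ∷ w))))
    ≡⟨ ∑.sum-cong-≗ (λ j → trans
         (total-cong (λ w → guard-∧ (does (∉? j w)) (does (unique? w)) (φ (j ∷ w))) (words (suc n) n))
         (total-words-avoiding j (λ w → guard (does (unique? w)) (φ (j ∷ w))))) ⟩
  sum (λ j → total (words n n) (λ w → guard (does (unique? (Vec.map (punchIn j) w))) (φ (j ∷ Vec.map (punchIn j) w))))
    ≡⟨ ∑.sum-cong-≗ (λ j → trans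
         (total-cong (λ w → cong (λ b → guard b (φ (j ∷ Vec.map (punchIn j) w)))
           (does-⇔ (mk⇔ (unique-map⁻ (punchIn j)) (Unique.map⁺ (punchIn-injective j _ _)))
                   (unique? (Vec.map (punchIn j) w)) (unique? w))) (words n n))
         (sym (total-filter unique? (λ w → φ (j ∷ Vec.map (punchIn j) w)) (words n n)))) ⟩
  sum (λ j → total (𝔖 n) λ σ → φ (j ∷ Vec.map (punchIn j) σ))
    ∎
  where open ≡-Reasoning

-- Partial sums over first letters.

-- The bound has one more value than there are letters, so the largest bound gives the full sum.
below : Fin (suc n) → (Fin n → ℚ) → ℚ
below         zero    a = 0ℚ
below {suc n} (suc j) a = a zero + below j (a ∘ suc)

below-suc : ∀ (j : Fin n) a → below (suc j) a ≡ below (inject₁ j) a + a j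
below-suc zero    a = ℚ.+-comm (a zero) 0ℚ
below-suc (suc j) a = trans (cong (_+_ (a zero)) (below-suc j (a ∘ suc)))
                            (sym (ℚ.+-assoc (a zero) _ (a (suc j))))

below-fromℕ : ∀ (a : Fin n → ℚ) → below (Fin.fromℕ n) a ≡ sum a
below-fromℕ {zero}  a = refl
below-fromℕ {suc n} a = cong (_+_ (a zero)) (below-fromℕ (a ∘ suc))

-- `punchIn j i` lies below j exactly when i does as a number, so the test cuts the sum after the
-- first `toℕ j` letters.
sum-if-below : ∀ (j : Fin (suc n)) (a b : Fin n → ℚ) →
  sum (λ i → if does (punchIn j i <? j) then a i else b i) ≡ below j a + (sum b - below j b)
sum-if-below zero a b = solve 1 (λ x → x := con 0ℚ :+ (x :- con 0ℚ)) refl (sum b)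
sum-if-below {suc n} (suc j) a b = trans
  (cong (_+_ (a zero)) (sum-if-below j (a ∘ suc) (b ∘ suc)))
  (solve 5 (λ a₀ b₀ x y z → a₀ :+ (x :+ (y :- z)) := a₀ :+ x :+ (b₀ :+ y :- (b₀ :+ z))) refl
    (a zero) (b zero) (below j (a ∘ suc)) (sum (b ∘ suc)) (below j (b ∘ suc)))

-- Descent weights and the transfer rule.

punchIn-<? : ∀ (j : Fin (suc n)) x y → does (punchIn j x <? punchIn j y) ≡ does (x <? y)
punchIn-<? j x y = does-⇔
  (mk⇔ (λ lt → ℕ.≰⇒> (ℕ.<⇒≱ lt ∘ punchIn-mono-≤ j y x))
       (λ lt → ℕ.≰⇒> (ℕ.<⇒≱ lt ∘ punchIn-cancel-≤ j y x)))
  (punchIn j x <? punchIn j y) (x <? y)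

-- A descent is weighted by -1 after an ascent and by s after a descent; the
-- first letter has no predecessor, and a descent from it is weighted by c.
-- At c = s this gives (-1)^des when s = -1 and (-1)^pk when s = 1.
module Weight (s : ℚ) where

  weight : ℚ → Vec (Fin n) k → ℚ
  weight c (x ∷ y ∷ w) = if does (y <? x) then c * weight s (y ∷ w) else weight (- 1ℚ) (y ∷ w)
  weight c _           = 1ℚ

  weight-punchIn : ∀ (j : Fin (suc n)) c (w : Vec (Fin n) k) →
                   weight c (Vec.map (punchIn j) w) ≡ weight c w
  weight-punchIn j c []          = refl
  weight-punchIn j c (x ∷ [])    = refl
  weight-punchIn j c (x ∷ y ∷ w) = trans
    (cong (λ b → if b then c * weight s (Vec.map (punchIn j) (y ∷ w)) else weight (- 1ℚ) (Vec.map (punchIn j) (y ∷ w)))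
          (punchIn-<? j y x))
    (cong₂ (λ u v → if does (y <? x) then c * u else v)
      (weight-punchIn j s (y ∷ w)) (weight-punchIn j (- 1ℚ) (y ∷ w)))

  W : ℚ → ℕ → ℚ
  W c n = total (𝔖 n) (weight c)

  -- The part of W c (suc n) contributed by permutations starting with j.
  T : ℚ → ∀ n → Fin (suc n) → ℚ
  T c n j = total (𝔖 n) λ σ → weight c (j ∷ Vec.map (punchIn j) σ)

  W-suc : ∀ c n → W c (suc n) ≡ sum (T c n)
  W-suc c n = total-𝔖 n (weight c)

  -- Sorted by the second letter: if it is below j, there is a descent of weight c and the rest
  -- starts after a descent (parameter s); otherwise the rest starts after an ascent (parameter -1).
  T-suc : ∀ c n (j : Fin (suc (suc n))) →
          T c (suc n) j ≡ c * below j (T s n) + (W (- 1ℚ) (suc n) - below j (T (- 1ℚ) n))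
  T-suc c n j = begin
    T c (suc n) j
      ≡⟨ total-𝔖 n (λ σ → weight c (j ∷ Vec.map (punchIn j) σ)) ⟩
    sum (λ i → total (𝔖 n) λ σ → weight c (j ∷ Vec.map (punchIn j) (i ∷ Vec.map (punchIn i) σ)))
      ≡⟨ ∑.sum-cong-≗ step ⟩
    sum (λ i → if does (punchIn j i <? j) then c * T s n i else T (- 1ℚ) n i)
      ≡⟨ sum-if-below j (λ i → c * T s n i) (T (- 1ℚ) n) ⟩
    below j (λ i → c * T s n i) + (sum (T (- 1ℚ) n) - below j (T (- 1ℚ) n))
      ≡⟨ cong₂ (λ x y → x + (y - below j (T (- 1ℚ) n))) (below-scale j (T s n)) (sym (W-suc (- 1ℚ) n)) ⟩
    c * below j (T s n) + (W (- 1ℚ) (suc n) - below j (T (- 1ℚ) n))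
      ∎
    where
    open ≡-Reasoning
    below-scale : ∀ {n} (j : Fin (suc n)) a → below j (λ i → c * a i) ≡ c * below j a
    below-scale         zero    a = sym (ℚ.*-zeroʳ c)
    below-scale {suc n} (suc j) a = trans (cong (_+_ (c * a zero)) (below-scale j (a ∘ suc)))
                                          (sym (ℚ.*-distribˡ-+ c (a zero) _))
    step : ∀ i → total (𝔖 n) (λ σ → weight c (j ∷ Vec.map (punchIn j) (i ∷ Vec.map (punchIn i) σ))) ≡
                 (if does (punchIn j i <? j) then c * T s n i else T (- 1ℚ) n i)
    step i with does (punchIn j i <? j)
    ... | true  = trans (total-cong (λ σ → cong (c *_) (weight-punchIn j s (i ∷ Vec.map (punchIn i) σ))) (𝔖 n))
                        (total-scale c _ (𝔖 n))
    ... | false = total-cong (λ σ → weight-punchIn j (- 1ℚ) (i ∷ Vec.map (punchIn i) σ)) (𝔖 n)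

-- Solution of the transfer rule by Leibniz products.

-- On egfs, the r-th derivative. In this form `drop (suc r) a` unfolds to the shifted factor in the
-- second summand of `_⊛_`.
drop : ℕ → Series → Series
drop zero    a = a
drop (suc r) a = drop r a ∘ suc

drop-+ : ∀ r a k → drop r a k ≡ a (r ℕ.+ k)
drop-+ zero    a k = refl
drop-+ (suc r) a k = trans (drop-+ r a (suc k)) (cong a (ℕ.+-suc r k))

-- As a sequence, the egf coefficients of e⁻ˣ; as a function of a statistic, the summand of
-- `statPoly` at t = -1.
ε : Series
ε = _^_ +-*-rawSemiring (- 1ℚ)

module Count (s : ℚ) (h : Series) (h₀ : h 0 ≡ 1ℚ) (h₁ : h 1 ≡ 0ℚ)
             (h₂ : ∀ n → h (suc (suc n)) ≡ (1ℚ + s) * h (suc n) + h n) where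

  open Weight s

  -- K and L are the egfs e⁻ˣ h and e⁻ˣ h′: they satisfy K′ = L - K and
  -- L′ = K + s L, which is how the transfer rule for the first letter acts.
  U K L : Series
  U = W (- 1ℚ)
  K = ε ⊛ h
  L = ε ⊛ h ∘ suc

  K₀ : K 0 ≡ 1ℚ
  K₀ = cong (1ℚ *_) h₀

  L₀ : L 0 ≡ 0ℚ
  L₀ = cong (1ℚ *_) h₁

  K-suc : ∀ n → K (suc n) ≡ - 1ℚ * K n + L n
  K-suc n = cong (_+ L n) (⊛-scaleˡ (- 1ℚ) ε h n)

  L-suc : ∀ n → L (suc n) ≡ K n + s * L n
  L-suc n = begin
    (ε ∘ suc ⊛ h′) n + (ε ⊛ h′ ∘ suc) n
      ≡⟨ cong₂ _+_ (⊛-scaleˡ (- 1ℚ) ε h′ n) (⊛-cong {ε} (λ _ → refl) h₂ n) ⟩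
    - 1ℚ * L n + (ε ⊛ (λ m → (1ℚ + s) * h′ m + h m)) n
      ≡⟨ cong (_+_ (- 1ℚ * L n)) (⊛-distribˡ-+ ε (λ m → (1ℚ + s) * h′ m) h n) ⟩
    - 1ℚ * L n + ((ε ⊛ (λ m → (1ℚ + s) * h′ m)) n + K n)
      ≡⟨ cong (λ x → - 1ℚ * L n + (x + K n)) (begin
           (ε ⊛ (λ m → (1ℚ + s) * h′ m)) n   ≡⟨ ⊛-comm ε _ n ⟩
           ((λ m → (1ℚ + s) * h′ m) ⊛ ε) n   ≡⟨ ⊛-scaleˡ (1ℚ + s) h′ ε n ⟩
           (1ℚ + s) * (h′ ⊛ ε) n             ≡⟨ cong ((1ℚ + s) *_) (⊛-comm h′ ε n) ⟩
           (1ℚ + s) * L n                    ∎) ⟩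
    - 1ℚ * L n + ((1ℚ + s) * L n + K n)
      ≡⟨ solve 3 (λ s k l → con (- 1ℚ) :* l :+ ((con 1ℚ :+ s) :* l :+ k) := k :+ s :* l) refl s (K n) (L n) ⟩
    K n + s * L n
      ∎
    where
    open ≡-Reasoning
    h′ : Series
    h′ = h ∘ suc

  -- The antiderivative of K + c L with constant term 0. It equals L at c = s and 1 - K at c = -1.
  α : ℚ → Series
  α c zero    = 0ℚ
  α c (suc n) = K n + c * L n

  αₛ≗L : α s ≗ L
  αₛ≗L zero    = sym L₀
  αₛ≗L (suc n) = sym (L-suc n)

  α₋₁+K≗δ : ∀ n → α (- 1ℚ) n + K n ≡ δ n
  α₋₁+K≗δ zero    = trans (ℚ.+-identityˡ (K 0)) K₀
  α₋₁+K≗δ (suc n) = trans (cong (_+_ (K n + - 1ℚ * L n)) (K-suc n))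
    (solve 2 (λ k l → k :+ con (- 1ℚ) :* l :+ (con (- 1ℚ) :* k :+ l) := con 0ℚ) refl (K n) (L n))

  α₋₁⊛+K⊛ : ∀ V n → (α (- 1ℚ) ⊛ V) n + (K ⊛ V) n ≡ V n
  α₋₁⊛+K⊛ V n = begin
    (α (- 1ℚ) ⊛ V) n + (K ⊛ V) n       ≡⟨ ⊛-distribʳ-+ (α (- 1ℚ)) K V n ⟨
    ((λ m → α (- 1ℚ) m + K m) ⊛ V) n   ≡⟨ ⊛-cong {b = V} α₋₁+K≗δ (λ _ → refl) n ⟩
    (δ ⊛ V) n                          ≡⟨ ⊛-identityˡ V n ⟩
    V n                                ∎
    where open ≡-Reasoning

  -- Mutual induction with `T-⊛`. The Leibniz rule at `suc k` mirrors the extension of a partial sum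
  -- by one first letter: `α c ⊛ drop (suc r) U` is the old partial sum and `α c ∘ suc ⊛ drop r U`
  -- the added term. The equations on r + k make the binomial sum combine entries of `α c` and U
  -- with total index `suc n`.
  below-T : ∀ c r {n k} (j : Fin (suc (suc n))) → toℕ j ≡ k → r ℕ.+ k ≡ suc n →
            below j (T c n) ≡ (α c ⊛ drop r U) k
  T-⊛ : ∀ c r {n k} (j : Fin (suc n)) → toℕ j ≡ k → r ℕ.+ k ≡ n →
        T c n j ≡ (α c ∘ suc ⊛ drop r U) k

  below-T c r {k = zero}  zero    j≡k r+k≡n = sym (ℚ.*-zeroˡ (drop r U 0))
  below-T c r {n} {suc k} (suc j) j≡k r+k≡n = begin
    below (suc j) (T c n)                                    ≡⟨ below-suc j (T c n) ⟩
    below (inject₁ j) (T c n) + T c n j                      ≡⟨ cong₂ _+_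
      (below-T c (suc r) (inject₁ j) (trans (toℕ-inject₁ j) (ℕ.suc-injective j≡k)) (trans (sym (ℕ.+-suc r k)) r+k≡n))
      (T-⊛ c r j (ℕ.suc-injective j≡k) (ℕ.suc-injective (trans (sym (ℕ.+-suc r k)) r+k≡n))) ⟩
    (α c ⊛ drop (suc r) U) k + (α c ∘ suc ⊛ drop r U) k      ≡⟨ ℚ.+-comm ((α c ⊛ drop (suc r) U) k) _ ⟩
    (α c ⊛ drop r U) (suc k)                                 ∎
    where open ≡-Reasoning

  -- The only permutation of length 1 has weight 1, which the initial values of K and L reproduce
  -- for every c.
  T-⊛ c zero {zero} {zero} zero j≡k r+k≡n = sym (begin
    (K 0 + c * L 0) * 1ℚ     ≡⟨ cong₂ (λ x y → (x + c * y) * 1ℚ) K₀ L₀ ⟩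
    (1ℚ + c * 0ℚ) * 1ℚ       ≡⟨ solve 1 (λ c → (con 1ℚ :+ c :* con 0ℚ) :* con 1ℚ := con 1ℚ) refl c ⟩
    1ℚ                       ∎)
    where open ≡-Reasoning
  T-⊛ c r {suc n} {k} j j≡k r+k≡n = begin
    T c (suc n) j
      ≡⟨ T-suc c n j ⟩
    c * below j (T s n) + (U (suc n) - below j (T (- 1ℚ) n))
      ≡⟨ cong₂ (λ x y → c * x + (U (suc n) - y))
           (trans (below-T s r j j≡k r+k≡n) (⊛-cong {b = V} αₛ≗L (λ _ → refl) k))
           (below-T (- 1ℚ) r j j≡k r+k≡n) ⟩
    c * (L ⊛ V) k + (U (suc n) - (α (- 1ℚ) ⊛ V) k)
      -- `U (suc n)` is `V k`, and V splits as (α₋₁ + K) V, so the partial sum with c = -1 cancels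
      -- and K V remains.
      ≡⟨ cong (λ x → c * (L ⊛ V) k + (x - (α (- 1ℚ) ⊛ V) k))
           (trans (cong U (sym r+k≡n)) (trans (sym (drop-+ r U k)) (sym (α₋₁⊛+K⊛ V k)))) ⟩
    c * (L ⊛ V) k + ((α (- 1ℚ) ⊛ V) k + (K ⊛ V) k - (α (- 1ℚ) ⊛ V) k)
      ≡⟨ solve 3 (λ x y z → x :+ (y :+ z :- y) := z :+ x) refl (c * (L ⊛ V) k) ((α (- 1ℚ) ⊛ V) k) ((K ⊛ V) k) ⟩
    (K ⊛ V) k + c * (L ⊛ V) k
      ≡⟨ cong (_+_ ((K ⊛ V) k)) (⊛-scaleˡ c L V k) ⟨
    (K ⊛ V) k + ((λ m → c * L m) ⊛ V) k
      ≡⟨ ⊛-distribʳ-+ K (λ m → c * L m) V k ⟨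
    (α c ∘ suc ⊛ V) k
      ∎
    where
    open ≡-Reasoning
    V : Series
    V = drop r U

  -- The largest bound, with r = 0. The index starts at `suc n` because `α c ⊛ U` has constant term
  -- 0 while `W c 0` is 1; this is the missing constant term of `egf⁺`.
  W-⊛ : ∀ c n → W c (suc n) ≡ (α c ⊛ U) (suc n)
  W-⊛ c n = begin
    W c (suc n)                        ≡⟨ W-suc c n ⟩
    sum (T c n)                      ≡⟨ below-fromℕ (T c n) ⟨
    below (Fin.fromℕ (suc n)) (T c n)  ≡⟨ below-T c 0 (Fin.fromℕ (suc n)) (toℕ-fromℕ (suc n)) refl ⟩
    (α c ⊛ U) (suc n)                  ∎
    where open ≡-Reasoning

  -- At c = -1 the weighted count is U itself, so for positive degrees U = (1 - K) U, which leaves K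
  -- U = 0 there.
  K⊛U≗δ : K ⊛ U ≗ δ
  K⊛U≗δ zero    = cong (_* 1ℚ) K₀
  K⊛U≗δ (suc n) = begin
    y                    ≡⟨ solve 2 (λ x y → y := x :+ y :- x) refl x y ⟩
    x + y - x            ≡⟨ cong₂ _-_ (α₋₁⊛+K⊛ U (suc n)) (sym (W-⊛ (- 1ℚ) n)) ⟩
    U (suc n) - U (suc n) ≡⟨ ℚ.+-inverseʳ (U (suc n)) ⟩
    0ℚ                   ∎
    where
    open ≡-Reasoning
    x y : ℚ
    x = (α (- 1ℚ) ⊛ U) (suc n)
    y = (K ⊛ U) (suc n)

  -- Regrouping e⁻ˣ h′ U h as h′ (e⁻ˣ h U) exposes the factor K U = 1.
  L⊛U⊛h≗h′ : (L ⊛ U) ⊛ h ≗ h ∘ suc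
  L⊛U⊛h≗h′ n = begin
    ((ε ⊛ h′ ⊛ U) ⊛ h) n          ≡⟨ ⊛-cong {b = h} (⊛-cong {b = U} (⊛-comm ε h′) (λ _ → refl)) (λ _ → refl) n ⟩
    ((h′ ⊛ ε ⊛ U) ⊛ h) n          ≡⟨ ⊛-assoc (h′ ⊛ ε) U h n ⟩
    ((h′ ⊛ ε) ⊛ (U ⊛ h)) n        ≡⟨ ⊛-assoc h′ ε (U ⊛ h) n ⟩
    (h′ ⊛ (ε ⊛ (U ⊛ h))) n        ≡⟨ ⊛-cong {h′} (λ _ → refl) (λ m → trans
                                       (⊛-cong {ε} (λ _ → refl) (⊛-comm U h) m)
                                       (trans (sym (⊛-assoc ε h U m)) (K⊛U≗δ m))) n ⟩
    (h′ ⊛ δ) n                    ≡⟨ ⊛-comm h′ δ n ⟩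
    (δ ⊛ h′) n                    ≡⟨ ⊛-identityˡ h′ n ⟩
    h′ n                          ∎
    where
    open ≡-Reasoning
    h′ : Series
    h′ = h ∘ suc

  egf⁺-W : egf⁺ (W s) ≗ egf (L ⊛ U)
  egf⁺-W zero    = sym (trans (ℚ.*-identityʳ (L 0 * 1ℚ)) (trans (ℚ.*-identityʳ (L 0)) L₀))
  egf⁺-W (suc n) = cong (_* _) (trans (W-⊛ s n) (⊛-cong {b = U} αₛ≗L (λ _ → refl) (suc n)))

  egf⁺-W≗d/dx-log : .{{_ : NonZero (egf h 0)}} → egf⁺ (W s) ≗ d/dx (egf h) / egf h
  egf⁺-W≗d/dx-log = /-unique (egf⁺ (W s)) (d/dx (egf h)) (egf h) λ n → begin
    (egf⁺ (W s) · egf h) n    ≡⟨ ·-cong {b = egf h} egf⁺-W (λ _ → refl) n ⟩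
    (egf (L ⊛ U) · egf h) n   ≡⟨ egf-⊛ (L ⊛ U) h n ⟨
    egf ((L ⊛ U) ⊛ h) n       ≡⟨ cong (_* _) (L⊛U⊛h≗h′ n) ⟩
    egf (h ∘ suc) n           ≡⟨ d/dx-egf h n ⟨
    d/dx (egf h) n            ∎
    where open ≡-Reasoning

-- Descents and peaks at t = -1 as weights.

ε-des : ∀ (w : Vec (Fin n) k) → ε (des w) ≡ Weight.weight (- 1ℚ) (- 1ℚ) w
ε-des []          = refl
ε-des (x ∷ [])    = refl
ε-des (x ∷ y ∷ w) with does (y <? x) | ε-des (y ∷ w)
... | true  | ih = cong (- 1ℚ *_) ih
... | false | ih = ih

-- `pk` tests for an ascent and `weight` for a descent; these tests are complementary only for
-- distinct letters, hence the `Unique` hypotheses below.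
<?-flip : ∀ {x y : Fin n} → x ≢ y → does (x <? y) ≡ not (does (y <? x))
<?-flip {x = x} {y} x≢y with <-cmp x y
... | tri< x<y _ y≮x = trans (dec-true (x <? y) x<y) (sym (cong not (dec-false (y <? x) y≮x)))
... | tri≈ _ x≡y _   = contradiction x≡y x≢y
... | tri> x≮y _ y<x = trans (dec-false (x <? y) x≮y) (sym (cong not (dec-true (y <? x) y<x)))

-- The letter y is a peak exactly when it is a descent entered by an ascent. The parameter of
-- `weight` records how y was entered: -1 after an ascent, 1 after a descent.
ε-pk-∷∷ : ∀ (x y : Fin n) (w : Vec (Fin n) k) → Unique (x ∷ y ∷ w) →
          ε (pk (x ∷ y ∷ w)) ≡ Weight.weight 1ℚ (if does (y <? x) then 1ℚ else - 1ℚ) (y ∷ w)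
ε-pk-∷∷ x y []      _                     = refl
ε-pk-∷∷ x y (z ∷ w) ((x≢y ∷ _) ∷ unique) with ε-pk-∷∷ y z w unique
-- After the flip, both sides depend only on the tests y < x and z < y.
... | ih rewrite <?-flip x≢y with does (y <? x) | does (z <? y)
... | true  | true  = trans ih (sym (ℚ.*-identityˡ _))
... | true  | false = ih
... | false | true  = cong (- 1ℚ *_) ih
... | false | false = ih

-- The first letter is never a peak, so a descent from it has weight 1, which is also s.
ε-pk : ∀ (w : Vec (Fin n) k) → Unique w → ε (pk w) ≡ Weight.weight 1ℚ 1ℚ w
ε-pk []          _      = refl
ε-pk (x ∷ [])    _      = refl
ε-pk (x ∷ y ∷ w) unique = trans (ε-pk-∷∷ x y w unique) (select (does (y <? x)))
  where
  open Weight 1ℚ using (weight)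
  select : ∀ b → weight (if b then 1ℚ else - 1ℚ) (y ∷ w) ≡
                 (if b then 1ℚ * weight 1ℚ (y ∷ w) else weight (- 1ℚ) (y ∷ w))
  select true  = sym (ℚ.*-identityˡ _)
  select false = refl

f-suc-suc : ∀ n → f (suc (suc n)) ≡ f n
f-suc-suc n = cong (if_then 1ℚ else 0ℚ) (
  does-⇔ (mk⇔ (λ d → ∣m+n∣m⇒∣n d ∣-refl) (∣m∣n⇒∣m+n ∣-refl)) (2 ∣? suc (suc n)) (2 ∣? n))

egf⁺-cong : ∀ {a b} → a ≗ b → egf⁺ a ≗ egf⁺ b
egf⁺-cong a≗b zero    = refl
egf⁺-cong a≗b (suc n) = cong (_* _) (a≗b (suc n))

theorem1 : (A (- 1ℚ) ≗ d/dx F / F) × (Pᵖᵏ (- 1ℚ) ≗ d/dx G / G)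
theorem1 =
  (λ n → trans (egf⁺-cong (λ m → total-cong ε-des (𝔖 m)) n)
               (Count.egf⁺-W≗d/dx-log (- 1ℚ) f refl refl f-rec n)) ,
  -- Unlike `ε-des`, which holds for all words, `ε-pk` needs distinct letters, so the summands are
  -- compared only on the filtered list.
  (λ n → trans (egf⁺-cong (λ m → total-filter-cong unique? ε-pk (words m m)) n)
               (Count.egf⁺-W≗d/dx-log 1ℚ g refl refl (λ _ → refl) n))
  where
  -- At s = -1 the coefficient 1 + s vanishes and the equation for h becomes f″ = f; at s = 1 it is
  -- the Pell recurrence as defined.
  f-rec : ∀ n → f (suc (suc n)) ≡ (1ℚ + - 1ℚ) * f (suc n) + f n
  f-rec n = trans (f-suc-suc n) (solve 2 (λ x y → y := (con 1ℚ :+ con (- 1ℚ)) :* x :+ y) refl (f (suc n)) (f n))
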